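{- Let $p,q\ge1$, $u\in\mathfrak{S}_p$, $v\in\mathfrak{S}_q$. For $w\in\mathfrak{S}_{p+q}$ let $A^w_{u,v}$ be the set of $\zeta\in\mathfrak{S}^{(p,q)}$ such that (i) $(u\times v)\cdot\zeta^{ -1}\le w$, and (ii) whenever $u'\in\mathfrak{S}_p$, $v'\in\mathfrak{S}_q$ satisfy $u\le u'$, $v\le v'$ and $(u'\times v')\cdot\zeta^{ -1}\le w$, then $u'=u$ and $v'=v$. Let $\alpha^w_{u,v}=\#A^w_{u,v}$. Then $$\mathcal{M}_u\cdot\mathcal{M}_v=\sum_{w\in\mathfrak{S}_{p+q}}\alpha^w_{u,v}\,\mathcal{M}_w .$$
   Context: Permutations in one-line notation, product is composition. For $u\in\mathfrak{S}_p,v\in\mathfrak{S}_q$, $u\times v\in\mathfrak{S}_{p+q}$ has $(u\times v)(i)=u_i$ ($i\le p$), $(u\times v)(p+j)=p+v_j$. $\mathfrak{S}^{(p,q)}=\{\zeta\in\mathfrak{S}_{p+q}:\zeta_1<\cdots<\zeta_p,\zeta_{p+1}<\cdots<\zeta_{p+q}\}$. $\mathrm{st}(a_1,\ldots,a_m)\in\mathfrak{S}_m$ is the permutation with the same relative order as the distinct integers $a_i$. $\mathfrak{S}Sym$ is the graded Hopf algebra over $\mathbb{Q}$ with basis $\{\mathcal{F}_u:u\in\mathfrak{S}_n,n\ge0\}$, product $\mathcal{F}_u\cdot\mathcal{F}_v=\sum_{\zeta\in\mathfrak{S}^{(p,q)}}\mathcal{F}_{(u\times v)\cdot\zeta^{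 -1}}$, coproduct $\Delta(\mathcal{F}_u)=\sum_{p=0}^n\mathcal{F}_{\mathrm{st}(u_1..u_p)}\otimes\mathcal{F}_{\mathrm{st}(u_{p+1}..u_n)}$. Weak order: $u\le v$ iff $\mathrm{Inv}(u)\subseteq\mathrm{Inv}(v)$, $\mathrm{Inv}(u)=\{(i,j):i<j,u_i>u_j\}$, Möbius function $\mu$. Monomial basis: $\mathcal{M}_u=\sum_{v\ge u}\mu(u,v)\mathcal{F}_v$, equivalently $\mathcal{F}_u=\sum_{v\ge u}\mathcal{M}_v$. -}

module Defs where

open import Data.Bool.Base using (if_then_else_)
open import Data.Fin.Base as Fin using (Fin; zero; suc; toℕ; fromℕ<; punchIn; _↑ˡ_; _↑ʳ_)
open import Data.Fin.Permutation using (Permutation′; _⟨$⟩ʳ_; _⟨$⟩ˡ_; _≈_; _∘ₚ_; flip; id; insert; remove; insert-remove; inverseˡ; inverseʳ)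
open import Data.Fin.Properties as Finₚ using (+↔⊎; toℕ-fromℕ<; toℕ-injective; toℕ<n; punchIn-injective)
open import Data.Integer.Base using (+_)
open import Data.List.Base using (List; []; _∷_; map; foldr; filter; length; concatMap; allFin; cartesianProduct; cartesianProductWith)
open import Data.List.Membership.Propositional using (_∈_)
open import Data.List.Membership.Propositional.Properties using (∈-allFin; ∈-cartesianProduct⁺)
import Data.List.Membership.Setoid.Properties as Membershipₛ
open import Data.List.Relation.Unary.All using (all?; []; universal; lookupWith)
open import Data.List.Relation.Unary.AllPairs using ([]; _∷_)
open import Data.List.Relation.Unary.Any using (here; there)
import Data.List.Relation.Unary.Enumerates.Setoid as Enumerates
import Data.List.Relation.Unary.Unique.Propositional.Properties as Uniqueₚ
import Data.List.Relation.Unary.Unique.Setoid as Unique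
import Data.List.Relation.Unary.Unique.Setoid.Properties as Uniqueₛ
open import Data.Nat.Base as ℕ using (ℕ; zero; suc; z≤n; s≤s)
open import Data.Nat.Induction using (<-wellFounded)
import Data.Nat.Properties as ℕₚ
open import Data.Product.Base using (Σ; _×_; _,_; proj₁; proj₂)
open import Data.Rational.Base using (ℚ; 0ℚ; 1ℚ; _+_; _*_; -_; _/_)
open import Data.Sum.Base using (inj₁; inj₂)
open import Data.Sum.Function.Propositional using (_⊎-↔_)
open import Function.Base using (_∘_)
open import Function.Construct.Composition using (_↔-∘_)
open import Function.Construct.Symmetry using (↔-sym)
open import Induction.WellFounded using (WellFounded; Acc; acc; module Subrelation)
open import Level using (0ℓ)
open import Relation.Binary.Bundles using (Setoid)
import Relation.Binary.Construct.NonStrictToStrict as ToStrict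
import Relation.Binary.Construct.On as On
open import Relation.Binary.Core using (Rel)
open import Relation.Binary.Definitions as Binary using (tri<; tri≈; tri>)
open import Relation.Binary.PropositionalEquality using (_≡_; refl; sym; trans; cong; subst; subst₂; setoid)
open import Relation.Nullary using (¬_; Dec; yes; no; does; contradiction)
open import Relation.Nullary.Decidable using (map′; ¬?; _×-dec_; _→-dec_)
open import Relation.Unary using (Pred; Decidable; _⊆′_)

private
  variable
    n p q : ℕ

-- Points are numbered from 0, so u ⟨$⟩ʳ i is the entry u_{i+1} of the
-- one-line notation.  Equality of permutations is the pointwise _≈_.
𝔖 : ℕ → Set
𝔖 = Permutation′

infixl 7 _·ₚ_

-- (u ·ₚ v)(i) = u(v(i)), whereas _∘ₚ_ applies its left argument first.
_·ₚ_ : 𝔖 n → 𝔖 n → 𝔖 n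
u ·ₚ v = v ∘ₚ u

infixr 8 _×ₚ_

_×ₚ_ : 𝔖 p → 𝔖 q → 𝔖 (p ℕ.+ q)
u ×ₚ v = ↔-sym +↔⊎ ↔-∘ ((u ⊎-↔ v) ↔-∘ +↔⊎)

×ₚ-left : (u : 𝔖 p) (v : 𝔖 q) (i : Fin p) → (u ×ₚ v) ⟨$⟩ʳ (i ↑ˡ q) ≡ (u ⟨$⟩ʳ i) ↑ˡ q
×ₚ-left {p} {q} u v i rewrite Finₚ.splitAt-↑ˡ p i q = refl

×ₚ-right : (u : 𝔖 p) (v : 𝔖 q) (j : Fin q) → (u ×ₚ v) ⟨$⟩ʳ (p ↑ʳ j) ≡ p ↑ʳ (v ⟨$⟩ʳ j)
×ₚ-right {p} {q} u v j rewrite Finₚ.splitAt-↑ʳ p q j = refl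

_≈?_ : Binary.Decidable (_≈_ {n} {n})
u ≈? v = Finₚ.all? λ i → (u ⟨$⟩ʳ i) Finₚ.≟ (v ⟨$⟩ʳ i)

𝔖-setoid : ℕ → Setoid 0ℓ 0ℓ
𝔖-setoid n = record
  { Carrier       = 𝔖 n
  ; _≈_           = _≈_
  ; isEquivalence = record
    { refl  = λ _ → refl
    ; sym   = λ u≈v i → sym (u≈v i)
    ; trans = λ u≈v v≈w i → trans (u≈v i) (v≈w i)
    }
  }

allPerms : (n : ℕ) → List (𝔖 n)
allPerms zero    = id ∷ []
allPerms (suc n) = cartesianProductWith (insert zero) (allFin (suc n)) (allPerms n)

allPerms-complete : ∀ n → Enumerates.IsEnumeration (𝔖-setoid n) (allPerms n)
allPerms-complete zero    u = here λ ()
allPerms-complete (suc n) u =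
  Membershipₛ.∈-resp-≈ (𝔖-setoid (suc n)) {allPerms (suc n)} {insert zero (u ⟨$⟩ʳ zero) (remove zero u)} {u} (insert-remove zero u)
    (Membershipₛ.∈-cartesianProductWith⁺ (setoid (Fin (suc n))) (𝔖-setoid n) (𝔖-setoid (suc n))
      insert-cong (∈-allFin (u ⟨$⟩ʳ zero)) (allPerms-complete n (remove zero u)))
  where
  insert-cong : ∀ {i j : Fin (suc n)} {v w : 𝔖 n} → i ≡ j → v ≈ w → insert zero i v ≈ insert zero j w
  insert-cong refl v≈w zero    = refl
  insert-cong {i} refl v≈w (suc k) = cong (punchIn i) (v≈w k)

allPerms-unique : ∀ n → Unique.Unique (𝔖-setoid n) (allPerms n)
allPerms-unique zero    = [] ∷ []
allPerms-unique (suc n) =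
  Uniqueₛ.cartesianProductWith⁺ (setoid (Fin (suc n))) (𝔖-setoid n) (𝔖-setoid (suc n))
    (insert zero) insert-injective (Uniqueₚ.allFin⁺ (suc n)) (allPerms-unique n)
  where
  insert-injective : ∀ {i j : Fin (suc n)} {v w : 𝔖 n} → insert zero i v ≈ insert zero j w → i ≡ j × v ≈ w
  insert-injective {i} e with e zero
  ... | refl = refl , λ k → punchIn-injective i _ _ (e (suc k))

all𝔖? : {P : Pred (𝔖 n) 0ℓ} → (∀ {u v} → u ≈ v → P u → P v) → Decidable P → Dec (∀ u → P u)
all𝔖? {n} resp P? = map′
  (λ ps u → lookupWith (λ {x} px u≈x → resp {x} {u} (sym ∘ u≈x) px) ps (allPerms-complete n u))
  (λ f → universal f (allPerms n))
  (all? P? (allPerms n))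

Inv : 𝔖 n → Pred (Fin n × Fin n) 0ℓ
Inv u (i , j) = i Fin.< j × (u ⟨$⟩ʳ j) Fin.< (u ⟨$⟩ʳ i)

infix 4 _≤ʷ_ _<ʷ_ _≤ʷ?_ _<ʷ?_ _≈?_

_≤ʷ_ : Rel (𝔖 n) 0ℓ
u ≤ʷ v = Inv u ⊆′ Inv v

-- u <ʷ v is u ≤ʷ v × ¬ (u ≈ v).
_<ʷ_ : Rel (𝔖 n) 0ℓ
_<ʷ_ = ToStrict._<_ _≈_ _≤ʷ_

Inv? : (u : 𝔖 n) → Decidable (Inv u)
Inv? u (i , j) = i Finₚ.<? j ×-dec (u ⟨$⟩ʳ j) Finₚ.<? (u ⟨$⟩ʳ i)

_≤ʷ?_ : Binary.Decidable (_≤ʷ_ {n})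
u ≤ʷ? v = map′ (λ f (i , j) → f i j) (λ f i j → f (i , j))
  (Finₚ.all? λ i → Finₚ.all? λ j → Inv? u (i , j) →-dec Inv? v (i , j))

_<ʷ?_ : Binary.Decidable (_<ʷ_ {n})
_<ʷ?_ = ToStrict.<-decidable _≈_ _≤ʷ_ _≈?_ _≤ʷ?_

≤ʷ-reflexive : {u v : 𝔖 n} → u ≈ v → u ≤ʷ v
≤ʷ-reflexive u≈v (i , j) (i<j , uj<ui) = i<j , subst₂ Fin._<_ (u≈v j) (u≈v i) uj<ui

≤ʷ-trans : {u v w : 𝔖 n} → u ≤ʷ v → v ≤ʷ w → u ≤ʷ w
≤ʷ-trans u≤v v≤w ij = v≤w ij ∘ u≤v ij

≤ʷ-antisym : {u v : 𝔖 n} → u ≤ʷ v → v ≤ʷ u → u ≈ v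
≤ʷ-antisym {n} {u} {v} u≤v v≤u i = trans (sym (fix (u ⟨$⟩ʳ i))) (cong (v ⟨$⟩ʳ_) (inverseˡ u))
  where
  StrictMono : (Fin n → Fin n) → Set
  StrictMono f = ∀ {k l} → k Fin.< l → f k Fin.< f l

  sameOrder : (a b : 𝔖 n) → a ≤ʷ b → b ≤ʷ a →
              ∀ k l → (a ⟨$⟩ʳ k) Fin.< (a ⟨$⟩ʳ l) → (b ⟨$⟩ʳ k) Fin.< (b ⟨$⟩ʳ l)
  sameOrder a b a≤b b≤a k l ak<al with Finₚ.<-cmp k l
  ... | tri> _ _ l<k = proj₂ (a≤b (l , k) (l<k , ak<al))
  ... | tri≈ _ refl _ = contradiction ak<al (ℕₚ.<-irrefl refl)
  ... | tri< k<l k≢l _ with Finₚ.<-cmp (b ⟨$⟩ʳ k) (b ⟨$⟩ʳ l)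
  ...   | tri< bk<bl _ _ = bk<bl
  ...   | tri≈ _ bk≡bl _ =
          contradiction (trans (sym (inverseˡ b)) (trans (cong (b ⟨$⟩ˡ_) bk≡bl) (inverseˡ b))) k≢l
  ...   | tri> _ _ bl<bk =
          contradiction (proj₂ (b≤a (k , l) (k<l , bl<bk))) (ℕₚ.<-asym ak<al)

  quotient-mono : (a b : 𝔖 n) → a ≤ʷ b → b ≤ʷ a → StrictMono (λ k → b ⟨$⟩ʳ (a ⟨$⟩ˡ k))
  quotient-mono a b a≤b b≤a k<l =
    sameOrder a b a≤b b≤a _ _ (subst₂ Fin._<_ (sym (inverseʳ a)) (sym (inverseʳ a)) k<l)

  mono⇒inflationary : (f : Fin n → Fin n) → StrictMono f → ∀ m k → toℕ k ≡ m → m ℕ.≤ toℕ (f k)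
  mono⇒inflationary f mono zero    k _   = z≤n
  mono⇒inflationary f mono (suc m) k k≡m = ℕₚ.≤-<-trans
    (mono⇒inflationary f mono m k⁻ k⁻≡m)
    (mono (subst₂ ℕ._<_ (sym k⁻≡m) (sym k≡m) ℕₚ.≤-refl))
    where
    m<n : m ℕ.< n
    m<n = ℕₚ.<-trans (ℕₚ.n<1+n m) (subst (ℕ._< n) k≡m (toℕ<n k))
    k⁻ : Fin n
    k⁻ = fromℕ< m<n
    k⁻≡m : toℕ k⁻ ≡ m
    k⁻≡m = toℕ-fromℕ< m<n

  fix : ∀ k → v ⟨$⟩ʳ (u ⟨$⟩ˡ k) ≡ k
  fix k = toℕ-injective (ℕₚ.≤-antisym
    (subst (λ x → toℕ (v ⟨$⟩ʳ (u ⟨$⟩ˡ k)) ℕ.≤ toℕ x)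
      (trans (cong (u ⟨$⟩ʳ_) (inverseˡ v)) (inverseʳ u))
      (mono⇒inflationary _ (quotient-mono v u v≤u u≤v) _ (v ⟨$⟩ʳ (u ⟨$⟩ˡ k)) refl))
    (mono⇒inflationary _ (quotient-mono u v u≤v v≤u) _ k refl))

module _ {A : Set} {P Q : Pred A 0ℓ} (P? : Decidable P) (Q? : Decidable Q) (P⊆Q : P ⊆′ Q) where

  length-filter-≤ : ∀ xs → length (filter P? xs) ℕ.≤ length (filter Q? xs)
  length-filter-≤ []       = z≤n
  length-filter-≤ (x ∷ xs) with P? x | Q? x
  ... | yes _ | yes _ = s≤s (length-filter-≤ xs)
  ... | yes a | no ¬b = contradiction (P⊆Q x a) ¬b
  ... | no _  | yes _ = ℕₚ.m≤n⇒m≤1+n (length-filter-≤ xs)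
  ... | no _  | no _  = length-filter-≤ xs

  length-filter-< : ∀ {y xs} → Q y → ¬ P y → y ∈ xs → length (filter P? xs) ℕ.< length (filter Q? xs)
  length-filter-< {xs = x ∷ xs} Qy ¬Py (here refl) with P? x | Q? x
  ... | yes a | _     = contradiction a ¬Py
  ... | no _  | yes _ = s≤s (length-filter-≤ xs)
  ... | no _  | no ¬b = contradiction Qy ¬b
  length-filter-< {xs = x ∷ xs} Qy ¬Py (there y∈xs) with P? x | Q? x
  ... | yes _ | yes _ = s≤s (length-filter-< Qy ¬Py y∈xs)
  ... | yes a | no ¬b = contradiction (P⊆Q x a) ¬b
  ... | no _  | yes _ = ℕₚ.m≤n⇒m≤1+n (length-filter-< Qy ¬Py y∈xs)
  ... | no _  | no _  = length-filter-< Qy ¬Py y∈xs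

inversionCount : 𝔖 n → ℕ
inversionCount {n} u = length (filter (Inv? u) (cartesianProduct (allFin n) (allFin n)))

<ʷ⇒inversionCount-< : {u v : 𝔖 n} → u <ʷ v → inversionCount u ℕ.< inversionCount v
<ʷ⇒inversionCount-< {n} {u} {v} (u≤v , u≉v) with Finₚ.any? (λ i → Finₚ.any? (λ j → Inv? v (i , j) ×-dec ¬? (Inv? u (i , j))))
... | yes (i , j , new , notOld) =
  length-filter-< (Inv? u) (Inv? v) u≤v new notOld
    (∈-cartesianProduct⁺ (∈-allFin i) (∈-allFin j))
... | no ¬∃ = contradiction (≤ʷ-antisym {u = u} {v} u≤v v≤u) u≉v
  where
  v≤u : v ≤ʷ u
  v≤u (i , j) b with Inv? u (i , j)
  ... | yes a = a
  ... | no ¬a = contradiction (i , j , b , ¬a) ¬∃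

<ʷ-wellFounded : WellFounded (_<ʷ_ {n})
<ʷ-wellFounded = Subrelation.wellFounded
  (λ {u} {v} → <ʷ⇒inversionCount-< {u = u} {v})
  (On.wellFounded inversionCount <-wellFounded)

sumℚ : {A : Set} → List A → (A → ℚ) → ℚ
sumℚ xs f = foldr (λ x s → f x + s) 0ℚ xs

-- μ(u,u) = 1 and μ(u,v) = - Σ_{u ≤ x < v} μ(u,x) for u ≉ v; when u ≰ v the
-- sum is empty, giving μ(u,v) = 0.
μ-acc : (u v : 𝔖 n) → Acc _<ʷ_ v → ℚ
μ-acc {n} u v (acc rec) =
  if does (u ≈? v) then 1ℚ else - sumℚ (allPerms n) (λ x → term x (u ≤ʷ? x ×-dec x <ʷ? v))
  where
  term : ∀ x → Dec (u ≤ʷ x × x <ʷ v) → ℚ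
  term x (yes (_ , x<v)) = μ-acc u x (rec x<v)
  term x (no _)          = 0ℚ

μ : 𝔖 n → 𝔖 n → ℚ
μ u v = μ-acc u v (<ʷ-wellFounded v)

-- Formal ℚ-linear combinations of the symbols 𝓕_u, u ∈ 𝔖 n, n ≥ 0.  Lists
-- are considered up to _≋_, equality of all coefficients, which presents
-- the ℚ-vector space with basis {𝓕_u}.
𝔖Sym : Set
𝔖Sym = List (ℚ × Σ ℕ 𝔖)

data _≈ᵇ_ : Rel (Σ ℕ 𝔖) 0ℓ where
  sameDegree : {u v : 𝔖 n} → u ≈ v → (n , u) ≈ᵇ (n , v)

_≈ᵇ?_ : Binary.Decidable _≈ᵇ_
(m , u) ≈ᵇ? (n , v) with m ℕₚ.≟ n
... | no m≢n   = no λ { (sameDegree _) → m≢n refl }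
... | yes refl = map′ sameDegree (λ { (sameDegree u≈v) → u≈v }) (u ≈? v)

coeff : 𝔖Sym → Σ ℕ 𝔖 → ℚ
coeff x b = sumℚ x λ { (c , b′) → if does (b′ ≈ᵇ? b) then c else 0ℚ }

infix 4 _≋_

_≋_ : Rel 𝔖Sym 0ℓ
x ≋ y = ∀ b → coeff x b ≡ coeff y b

infixr 8 _•_
infixl 7 _·_

_•_ : ℚ → 𝔖Sym → 𝔖Sym
c • x = map (λ { (d , b) → c * d , b }) x

∑ : {A : Set} → List A → (A → 𝔖Sym) → 𝔖Sym
∑ xs f = concatMap f xs

infix 6 ∑
syntax ∑ xs (λ x → e) = ∑[ x ∈ xs ] e

𝓕 : 𝔖 n → 𝔖Sym
𝓕 {n} u = (1ℚ , (n , u)) ∷ []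

-- The set 𝔖^{(p,q)}.
IsShuffle : (p q : ℕ) → Pred (𝔖 (p ℕ.+ q)) 0ℓ
IsShuffle p q ζ =
  (∀ (i j : Fin p) → i Fin.< j → (ζ ⟨$⟩ʳ (i ↑ˡ q)) Fin.< (ζ ⟨$⟩ʳ (j ↑ˡ q))) ×
  (∀ (i j : Fin q) → i Fin.< j → (ζ ⟨$⟩ʳ (p ↑ʳ i)) Fin.< (ζ ⟨$⟩ʳ (p ↑ʳ j)))

isShuffle? : (p q : ℕ) → Decidable (IsShuffle p q)
isShuffle? p q ζ =
  (Finₚ.all? λ i → Finₚ.all? λ j → i Finₚ.<? j →-dec (ζ ⟨$⟩ʳ (i ↑ˡ q)) Finₚ.<? (ζ ⟨$⟩ʳ (j ↑ˡ q))) ×-dec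
  (Finₚ.all? λ i → Finₚ.all? λ j → i Finₚ.<? j →-dec (ζ ⟨$⟩ʳ (p ↑ʳ i)) Finₚ.<? (ζ ⟨$⟩ʳ (p ↑ʳ j)))

shuffles : (p q : ℕ) → List (𝔖 (p ℕ.+ q))
shuffles p q = filter (isShuffle? p q) (allPerms (p ℕ.+ q))

𝓕-product : 𝔖 p → 𝔖 q → 𝔖Sym
𝓕-product {p} {q} u v = ∑[ ζ ∈ shuffles p q ] 𝓕 ((u ×ₚ v) ·ₚ flip ζ)

-- The bilinear extension of 𝓕_u · 𝓕_v.
_·_ : 𝔖Sym → 𝔖Sym → 𝔖Sym
x · y = ∑ x λ { (c , _ , u) → ∑ y λ { (d , _ , v) → (c * d) • 𝓕-product u v } }

𝓜 : 𝔖 n → 𝔖Sym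
𝓜 {n} u = ∑[ v ∈ filter (u ≤ʷ?_) (allPerms n) ] (μ u v • 𝓕 v)

Maximal : 𝔖 p → 𝔖 q → 𝔖 (p ℕ.+ q) → Pred (𝔖 (p ℕ.+ q)) 0ℓ
Maximal {p} {q} u v w ζ =
  (u′ : 𝔖 p) (v′ : 𝔖 q) → u ≤ʷ u′ → v ≤ʷ v′ → (u′ ×ₚ v′) ·ₚ flip ζ ≤ʷ w →
  u′ ≈ u × v′ ≈ v

A : 𝔖 p → 𝔖 q → 𝔖 (p ℕ.+ q) → Pred (𝔖 (p ℕ.+ q)) 0ℓ
A {p} {q} u v w ζ =
  IsShuffle p q ζ × (u ×ₚ v) ·ₚ flip ζ ≤ʷ w × Maximal u v w ζ

×ₚ-cong : {u u′ : 𝔖 p} {v v′ : 𝔖 q} → u ≈ u′ → v ≈ v′ → (u ×ₚ v) ≈ (u′ ×ₚ v′)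
×ₚ-cong {p} {q} {u} {u′} {v} {v′} u≈u′ v≈v′ k with Fin.splitAt p k
... | inj₁ i = cong (_↑ˡ q) (u≈u′ i)
... | inj₂ j = cong (p ↑ʳ_) (v≈v′ j)

maximal? : (u : 𝔖 p) (v : 𝔖 q) (w : 𝔖 (p ℕ.+ q)) → Decidable (Maximal u v w)
maximal? {p} {q} u v w ζ =
  all𝔖? {P = λ u′ → ∀ v′ → Body u′ v′}
    (λ {a} {b} a≈b f v′ → resp {a} {b} {v′} {v′} a≈b (λ _ → refl) (f v′))
    λ u′ → all𝔖? {P = Body u′}
      (λ {a} {b} → resp {u′} {u′} {a} {b} λ _ → refl)
      λ v′ → u ≤ʷ? u′ →-dec v ≤ʷ? v′ →-dec (u′ ×ₚ v′) ·ₚ flip ζ ≤ʷ? w →-dec (u′ ≈? u ×-dec v′ ≈? v)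
  where
  Body : 𝔖 p → 𝔖 q → Set
  Body u′ v′ = u ≤ʷ u′ → v ≤ʷ v′ → (u′ ×ₚ v′) ·ₚ flip ζ ≤ʷ w → u′ ≈ u × v′ ≈ v

  resp : ∀ {a b c d} → a ≈ b → c ≈ d → Body a c → Body b d
  resp {a} {b} {c} {d} a≈b c≈d f u≤b v≤d bd≤w
    with f (≤ʷ-trans {u = u} {b} {a} u≤b (≤ʷ-reflexive {u = b} {a} (sym ∘ a≈b)))
           (≤ʷ-trans {u = v} {d} {c} v≤d (≤ʷ-reflexive {u = d} {c} (sym ∘ c≈d)))
           (≤ʷ-trans {u = (a ×ₚ c) ·ₚ flip ζ} {(b ×ₚ d) ·ₚ flip ζ} {w}
             (≤ʷ-reflexive {u = (a ×ₚ c) ·ₚ flip ζ} {(b ×ₚ d) ·ₚ flip ζ}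
               λ k → ×ₚ-cong {u = a} {b} {c} {d} a≈b c≈d (flip ζ ⟨$⟩ʳ k))
             bd≤w)
  ... | a≈u , c≈v = (λ i → trans (sym (a≈b i)) (a≈u i)) , (λ j → trans (sym (c≈d j)) (c≈v j))

A? : (u : 𝔖 p) (v : 𝔖 q) (w : 𝔖 (p ℕ.+ q)) → Decidable (A u v w)
A? {p} {q} u v w ζ =
  isShuffle? p q ζ ×-dec (u ×ₚ v) ·ₚ flip ζ ≤ʷ? w ×-dec maximal? u v w ζ

α : 𝔖 p → 𝔖 q → 𝔖 (p ℕ.+ q) → ℕ
α {p} {q} u v w = length (filter (A? u v w) (allPerms (p ℕ.+ q)))

fromℕ : ℕ → ℚ
fromℕ k = + k / 1

{-# OPTIONS --safe #-}
-- The down-sums Σ_{z ≤ y} [𝓕_z] determine an element of 𝔖Sym, by induction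
-- along the weak order, and Σ_{u ≤ x ≤ y} μ(u,x) = δ_{u,y} shows that the
-- down-sum of 𝓜_w at y is δ_{w,y}.  So it suffices that the down-sum of
-- 𝓜_u · 𝓜_v at y is α^y_{u,v}.  For a shuffle ζ, the condition
-- (u′ × v′) ζ⁻¹ ≤ y means that u′ ≤ L, v′ ≤ R and that the inversions of ζ⁻¹
-- between the two blocks are inversions of y, where L and R are the
-- standardisations of y ∘ ζ on the blocks.  Summing μ(u,u′) μ(v,v′) over all
-- such (u′,v′) leaves 1 when (u,v) = (L,R) and 0 otherwise; since (L,R) is the
-- largest element of the fibre, this counts exactly the ζ in A^y_{u,v}.

module Submission where

open import Defs
open import Data.Bool.Base using (if_then_else_)
open import Data.Fin.Base as Fin using (Fin; toℕ; fromℕ<; punchOut; splitAt; join; _↑ˡ_; _↑ʳ_)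
open import Data.Fin.Permutation using (_⟨$⟩ʳ_; _⟨$⟩ˡ_; _≈_; flip; permutation; inverseˡ; inverseʳ)
open import Data.Fin.Properties as Finₚ using (any?; all?; join-splitAt; toℕ-↑ˡ; toℕ-↑ʳ; toℕ-fromℕ<; toℕ<n; ↑ˡ-injective; ↑ʳ-injective)
import Data.Integer.Base as ℤ
import Data.Integer.Properties as ℤₚ
open import Data.List.Base using (List; []; _∷_; _++_; foldr; filter; length; concatMap; allFin)
open import Data.List.Membership.Propositional using (lose)
open import Data.List.Membership.Propositional.Properties using (∈-allFin)
open import Data.List.Properties using (filter-notAll; length-tabulate)
import Data.List.Membership.Setoid as Membership
open import Data.List.Relation.Unary.All as All using (All; []; _∷_)
open import Data.List.Relation.Unary.AllPairs using ([]; _∷_)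
open import Data.List.Relation.Unary.Any using (here; there)
import Data.List.Relation.Unary.Unique.Setoid as Unique
open import Data.Nat.Base using (ℕ; _+_; _≤_)
import Data.Nat.Base as ℕ
open import Data.Nat.Coprimality using (1-coprimeTo) renaming (sym to coprime-sym)
import Data.Nat.Properties as ℕₚ
open import Data.Product.Base using (Σ; ∃; _×_; _,_; proj₁; proj₂)
open import Data.Rational.Base as ℚ using (ℚ; 0ℚ; 1ℚ; _*_; -_; _/_)
open import Data.Rational.Properties as ℚₚ using (+-identityˡ; +-identityʳ; *-identityˡ; *-identityʳ; *-zeroˡ; *-zeroʳ; *-assoc; *-comm; *-distribˡ-+; *-distribʳ-+; +-inverseʳ; normalize-coprime)
open import Algebra.Properties.Group ℚₚ.+-0-group using (∙-cancelˡ)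
open import Data.Rational.Solver using (module +-*-Solver)
open import Data.Sum.Base using (_⊎_; inj₁; inj₂)
open import Function.Base using (_∘_)
open import Function.Definitions using (Injective)
open import Induction.WellFounded using (Acc; acc; WfRec)
open import Level using (0ℓ)
open import Relation.Binary.Definitions using (tri<; tri≈; tri>)
open import Relation.Binary.PropositionalEquality using (_≡_; _≢_; refl; sym; trans; cong; cong₂; subst; subst₂; module ≡-Reasoning)
open import Relation.Nullary using (¬_; Dec; yes; no; does; contradiction)
open import Relation.Nullary.Decidable using (_×-dec_; _→-dec_)
open import Relation.Unary using (Pred; Decidable)

open ≡-Reasoning

private
  variable
    n p q : ℕ
    P Q : Set
    I J : Set

-- Indicators and finite sums

if-yes : (d : Dec P) {a b : I} → P → (if does d then a else b) ≡ a
if-yes (yes _) _ = refl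
if-yes (no ¬p) p = contradiction p ¬p

if-no : (d : Dec P) {a b : I} → ¬ P → (if does d then a else b) ≡ b
if-no (yes p) ¬p = contradiction p ¬p
if-no (no _)  _  = refl

if-cong : (d : Dec P) (e : Dec Q) {a b b′ : I} → (P → Q) → (Q → P) → b ≡ b′ →
          (if does d then a else b) ≡ (if does e then a else b′)
if-cong (yes p) e f _ _    = sym (if-yes e (f p))
if-cong (no ¬p) e _ g refl = sym (if-no e (¬p ∘ g))

⟦_⟧ : Dec P → ℚ
⟦ d ⟧ = if does d then 1ℚ else 0ℚ

⟦⟧-yes : (d : Dec P) → P → ⟦ d ⟧ ≡ 1ℚ
⟦⟧-yes d = if-yes d

⟦⟧-no : (d : Dec P) → ¬ P → ⟦ d ⟧ ≡ 0ℚ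
⟦⟧-no d = if-no d

⟦⟧-cong : (d : Dec P) (e : Dec Q) → (P → Q) → (Q → P) → ⟦ d ⟧ ≡ ⟦ e ⟧
⟦⟧-cong d e f g = if-cong d e f g refl

⟦⟧-× : (d : Dec P) (e : Dec Q) → ⟦ d ×-dec e ⟧ ≡ ⟦ d ⟧ * ⟦ e ⟧
⟦⟧-× (yes _) e = sym (*-identityˡ ⟦ e ⟧)
⟦⟧-× (no _)  e = sym (*-zeroˡ ⟦ e ⟧)

-- Lets summands be compared under the condition that their indicator imposes. The induction
-- hypothesis below `y` and the shuffle hypothesis on `ζ` enter sums in this way.
⟦⟧-*-congʳ : (d : Dec P) {a b : ℚ} → (P → a ≡ b) → ⟦ d ⟧ * a ≡ ⟦ d ⟧ * b
⟦⟧-*-congʳ (yes p)         eq = cong (1ℚ *_) (eq p)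
⟦⟧-*-congʳ (no _) {a} {b} _  = trans (*-zeroˡ a) (sym (*-zeroˡ b))

*-swapˡ : ∀ a b c → a * (b * c) ≡ b * (a * c)
*-swapˡ = solve 3 (λ a b c → a :* (b :* c) := b :* (a :* c)) refl
  where open +-*-Solver

sum-cong : (xs : List I) {f g : I → ℚ} → (∀ x → f x ≡ g x) → sumℚ xs f ≡ sumℚ xs g
sum-cong []       eq = refl
sum-cong (x ∷ xs) eq = cong₂ ℚ._+_ (eq x) (sum-cong xs eq)

sum-zero : (xs : List I) {f : I → ℚ} → (∀ x → f x ≡ 0ℚ) → sumℚ xs f ≡ 0ℚ
sum-zero []       eq = refl
sum-zero (x ∷ xs) eq = cong₂ ℚ._+_ (eq x) (sum-zero xs eq)

sum-+ : (xs : List I) (f g : I → ℚ) → sumℚ xs (λ x → f x ℚ.+ g x) ≡ sumℚ xs f ℚ.+ sumℚ xs g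
sum-+ []       f g = refl
sum-+ (x ∷ xs) f g = trans (cong (f x ℚ.+ g x ℚ.+_) (sum-+ xs f g))
  (solve 4 (λ a b c d → a :+ b :+ (c :+ d) := a :+ c :+ (b :+ d)) refl (f x) (g x) (sumℚ xs f) (sumℚ xs g))
  where open +-*-Solver

sum-*ˡ : (xs : List I) (c : ℚ) (f : I → ℚ) → sumℚ xs (λ x → c * f x) ≡ c * sumℚ xs f
sum-*ˡ []       c f = sym (*-zeroʳ c)
sum-*ˡ (x ∷ xs) c f = trans (cong (c * f x ℚ.+_) (sum-*ˡ xs c f)) (sym (*-distribˡ-+ c (f x) (sumℚ xs f)))

sum-swap : (xs : List I) (ys : List J) (f : I → J → ℚ) →
           sumℚ xs (λ x → sumℚ ys (f x)) ≡ sumℚ ys (λ y → sumℚ xs (λ x → f x y))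
sum-swap []       ys f = sym (sum-zero ys (λ _ → refl))
sum-swap (x ∷ xs) ys f = trans (cong (sumℚ ys (f x) ℚ.+_) (sum-swap xs ys f))
  (sym (sum-+ ys (f x) (λ y → sumℚ xs (λ x → f x y))))

sum-++ : (xs ys : List I) (f : I → ℚ) → sumℚ (xs ++ ys) f ≡ sumℚ xs f ℚ.+ sumℚ ys f
sum-++ []       ys f = sym (+-identityˡ (sumℚ ys f))
sum-++ (x ∷ xs) ys f = trans (cong (f x ℚ.+_) (sum-++ xs ys f)) (sym (ℚₚ.+-assoc (f x) (sumℚ xs f) (sumℚ ys f)))

sum-concatMap : (xs : List I) (g : I → List J) (f : J → ℚ) →
                sumℚ (concatMap g xs) f ≡ sumℚ xs (λ x → sumℚ (g x) f)
sum-concatMap []       g f = refl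
sum-concatMap (x ∷ xs) g f = trans (sum-++ (g x) (concatMap g xs) f) (cong (sumℚ (g x) f ℚ.+_) (sum-concatMap xs g f))

fromℕ-suc : ∀ k → fromℕ (ℕ.suc k) ≡ 1ℚ ℚ.+ fromℕ k
-- For a variable `k` the fraction `+ k / 1` is stuck on a gcd; coprimality of `k` and 1 gives its
-- normal form, after which the addition computes.
fromℕ-suc k = sym (trans (cong (1ℚ ℚ.+_) (normalize-coprime (coprime-sym (1-coprimeTo k))))
  (cong (λ i → (ℤ.+ 1 ℤ.+ i) / 1) (ℤₚ.*-identityʳ (ℤ.+ k))))

module _ {P : Pred I 0ℓ} (P? : Decidable P) where

  sum-filter : ∀ xs (f : I → ℚ) → sumℚ (filter P? xs) f ≡ sumℚ xs (λ x → ⟦ P? x ⟧ * f x)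
  sum-filter []       f = refl
  sum-filter (x ∷ xs) f with P? x
  ... | yes _ = cong₂ ℚ._+_ (sym (*-identityˡ (f x))) (sum-filter xs f)
  ... | no _  = trans (sum-filter xs f)
    (sym (trans (cong (ℚ._+ _) (*-zeroˡ (f x))) (+-identityˡ _)))

  fromℕ-length-filter : ∀ xs → fromℕ (length (filter P? xs)) ≡ sumℚ xs (λ x → ⟦ P? x ⟧)
  fromℕ-length-filter []       = refl
  fromℕ-length-filter (x ∷ xs) with P? x
  ... | yes _ = trans (fromℕ-suc (length (filter P? xs))) (cong (1ℚ ℚ.+_) (fromℕ-length-filter xs))
  ... | no _  = trans (fromℕ-length-filter xs) (sym (+-identityˡ _))

-- Möbius inversion in the weak order

Respects≈ : (𝔖 n → ℚ) → Set
Respects≈ f = ∀ x y → x ≈ y → f x ≡ f y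

-- `allPerms` lists each `≈`-class exactly once, so a single term survives. Its index is only `≈` to
-- `y`, hence the condition on `f`.
sum-δ : (y : 𝔖 n) (f : 𝔖 n → ℚ) → Respects≈ f →
        sumℚ (allPerms n) (λ x → ⟦ x ≈? y ⟧ * f x) ≡ f y
sum-δ {n} y f resp = present (allPerms n) (allPerms-unique n) (allPerms-complete n y)
  where
  open Membership (𝔖-setoid n) using (_∈_)

  absent : ∀ xs → All (λ x → ¬ (x ≈ y)) xs → sumℚ xs (λ x → ⟦ x ≈? y ⟧ * f x) ≡ 0ℚ
  absent []       []         = refl
  absent (x ∷ xs) (x≉y ∷ ne) = cong₂ ℚ._+_
    (trans (cong (_* f x) (⟦⟧-no (x ≈? y) x≉y)) (*-zeroˡ (f x))) (absent xs ne)

  present : ∀ xs → Unique.Unique (𝔖-setoid n) xs → y ∈ xs → sumℚ xs (λ x → ⟦ x ≈? y ⟧ * f x) ≡ f y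
  present (x ∷ xs) (x≉ ∷ _) (here y≈x) = trans
    (cong₂ ℚ._+_
      (trans (cong (_* f x) (⟦⟧-yes (x ≈? y) (sym ∘ y≈x))) (*-identityˡ (f x)))
      (absent xs (All.map (λ x≉z z≈y → x≉z (λ i → sym (trans (z≈y i) (y≈x i)))) x≉)))
    (trans (+-identityʳ (f x)) (resp x y (sym ∘ y≈x)))
  present (x ∷ xs) (x≉ ∷ uniq) (there y∈xs) = trans
    (cong₂ ℚ._+_
      (trans (cong (_* f x) (⟦⟧-no (x ≈? y) x≉y)) (*-zeroˡ (f x)))
      (present xs uniq y∈xs))
    (+-identityˡ (f y))
    where
    x≉y : ¬ (x ≈ y)
    x≉y x≈y = All.lookupWith (λ x≉z y≈z → x≉z (λ i → trans (x≈y i) (y≈z i))) x≉ y∈xs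

⟦≤ʷ⟧-split : (x y : 𝔖 n) → ⟦ x ≤ʷ? y ⟧ ≡ ⟦ x <ʷ? y ⟧ ℚ.+ ⟦ x ≈? y ⟧
⟦≤ʷ⟧-split x y = split (x ≤ʷ? y) (x ≈? y) (x <ʷ? y)
  where
  split : (d : Dec (x ≤ʷ y)) (e : Dec (x ≈ y)) (c : Dec (x <ʷ y)) → ⟦ d ⟧ ≡ ⟦ c ⟧ ℚ.+ ⟦ e ⟧
  split d (yes x≈y) c = trans (⟦⟧-yes d (≤ʷ-reflexive {u = x} {y} x≈y))
    (sym (cong (ℚ._+ 1ℚ) (⟦⟧-no c (λ x<y → proj₂ x<y x≈y))))
  split d (no x≉y)  c = trans (⟦⟧-cong d c (_, x≉y) proj₁) (sym (+-identityʳ ⟦ c ⟧))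

-- Isolates the top term. What remains runs over strictly smaller permutations: for `μ` this is the
-- sum in its recursion, for coefficients the part known by induction.
sum-≤ʷ : (y : 𝔖 n) (f : 𝔖 n → ℚ) → Respects≈ f →
         sumℚ (allPerms n) (λ x → ⟦ x ≤ʷ? y ⟧ * f x) ≡ sumℚ (allPerms n) (λ x → ⟦ x <ʷ? y ⟧ * f x) ℚ.+ f y
sum-≤ʷ {n} y f resp = begin
  sumℚ (allPerms n) (λ x → ⟦ x ≤ʷ? y ⟧ * f x)
    ≡⟨ sum-cong (allPerms n) (λ x → trans (cong (_* f x) (⟦≤ʷ⟧-split x y)) (*-distribʳ-+ (f x) ⟦ x <ʷ? y ⟧ ⟦ x ≈? y ⟧)) ⟩
  sumℚ (allPerms n) (λ x → ⟦ x <ʷ? y ⟧ * f x ℚ.+ ⟦ x ≈? y ⟧ * f x)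
    ≡⟨ sum-+ (allPerms n) (λ x → ⟦ x <ʷ? y ⟧ * f x) (λ x → ⟦ x ≈? y ⟧ * f x) ⟩
  sumℚ (allPerms n) (λ x → ⟦ x <ʷ? y ⟧ * f x) ℚ.+ sumℚ (allPerms n) (λ x → ⟦ x ≈? y ⟧ * f x)
    ≡⟨ cong (sumℚ (allPerms n) (λ x → ⟦ x <ʷ? y ⟧ * f x) ℚ.+_) (sum-δ y f resp) ⟩
  sumℚ (allPerms n) (λ x → ⟦ x <ʷ? y ⟧ * f x) ℚ.+ f y ∎

-- The summands of μ-acc are local to its definition; unification against
-- the unfolding of μ-acc is what gives access to them.
mutual
  μ-step : (u v : 𝔖 n) → WfRec _<ʷ_ (Acc _<ʷ_) v → 𝔖 n → ℚ → ℚ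
  μ-step = _

  μ-acc-unfold : (u v : 𝔖 n) (rs : WfRec _<ʷ_ (Acc _<ʷ_) v) →
    μ-acc u v (acc rs) ≡ (if does (u ≈? v) then 1ℚ else - foldr (μ-step u v rs) 0ℚ (allPerms n))
  μ-acc-unfold u v rs = refl

foldr-cong : {f g : I → J → J} (e : J) → (∀ x s → f x s ≡ g x s) → ∀ xs → foldr f e xs ≡ foldr g e xs
foldr-cong         e eq []       = refl
foldr-cong {f = f} e eq (x ∷ xs) = trans (cong (f x) (foldr-cong e eq xs)) (eq x _)

mutual
  -- One induction gives both compatibility with `≈` and independence of the accessibility proof.
  -- The latter is needed at each recursive call, where the two unfoldings supply different proofs
  -- for the same `x`.
  μ-acc-cong : (u v v′ : 𝔖 n) → v ≈ v′ → (a : Acc _<ʷ_ v) (a′ : Acc _<ʷ_ v′) → μ-acc u v a ≡ μ-acc u v′ a′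
  μ-acc-cong u v v′ v≈v′ (acc rs) (acc rs′) = if-cong (u ≈? v) (u ≈? v′)
    (λ u≈v i → trans (u≈v i) (v≈v′ i)) (λ u≈v′ i → trans (u≈v′ i) (sym (v≈v′ i)))
    (cong -_ (foldr-cong 0ℚ (μ-step-cong u v v′ v≈v′ rs rs′) (allPerms _)))

  μ-step-cong : (u v v′ : 𝔖 n) → v ≈ v′ → (rs : WfRec _<ʷ_ (Acc _<ʷ_) v) (rs′ : WfRec _<ʷ_ (Acc _<ʷ_) v′) →
    ∀ x s → μ-step u v rs x s ≡ μ-step u v′ rs′ x s
  μ-step-cong u v v′ v≈v′ rs rs′ x s with u ≤ʷ? x ×-dec x <ʷ? v | u ≤ʷ? x ×-dec x <ʷ? v′
  ... | yes (_ , x<v) | yes (_ , x<v′) = cong (ℚ._+ s) (μ-acc-cong u x x (λ _ → refl) (rs x<v) (rs′ x<v′))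
  ... | no _          | no _           = refl
  ... | yes (u≤x , x≤v , x≉v) | no out = contradiction
    (u≤x , ≤ʷ-trans {u = x} {v} {v′} x≤v (≤ʷ-reflexive {u = v} {v′} v≈v′) , λ x≈v′ → x≉v (λ i → trans (x≈v′ i) (sym (v≈v′ i)))) out
  ... | no out | yes (u≤x , x≤v′ , x≉v′) = contradiction
    (u≤x , ≤ʷ-trans {u = x} {v′} {v} x≤v′ (≤ʷ-reflexive {u = v′} {v} (sym ∘ v≈v′)) , λ x≈v → x≉v′ (λ i → trans (x≈v i) (v≈v′ i))) out

μ-cong : (u v v′ : 𝔖 n) → v ≈ v′ → μ u v ≡ μ u v′
μ-cong u v v′ v≈v′ = μ-acc-cong u v v′ v≈v′ (<ʷ-wellFounded v) (<ʷ-wellFounded v′)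

-- Trades the case distinction that feeds an accessibility proof to the recursive call for an
-- indicator times `μ u x`, so that the rules for finite sums apply.
μ-step≡ : (u v : 𝔖 n) (rs : WfRec _<ʷ_ (Acc _<ʷ_) v) → ∀ x s →
  μ-step u v rs x s ≡ ⟦ u ≤ʷ? x ×-dec x <ʷ? v ⟧ * μ u x ℚ.+ s
μ-step≡ u v rs x s = by-cases (u ≤ʷ? x ×-dec x <ʷ? v)
  where
  inside : u ≤ʷ x × x <ʷ v → μ-step u v rs x s ≡ μ u x ℚ.+ s
  inside in′ with u ≤ʷ? x ×-dec x <ʷ? v
  ... | yes (_ , x<v) = cong (ℚ._+ s) (μ-acc-cong u x x (λ _ → refl) (rs x<v) (<ʷ-wellFounded x))
  ... | no out        = contradiction in′ out

  outside : ¬ (u ≤ʷ x × x <ʷ v) → μ-step u v rs x s ≡ 0ℚ ℚ.+ s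
  outside out with u ≤ʷ? x ×-dec x <ʷ? v
  ... | yes in′ = contradiction in′ out
  ... | no _    = refl

  by-cases : (d : Dec (u ≤ʷ x × x <ʷ v)) → μ-step u v rs x s ≡ ⟦ d ⟧ * μ u x ℚ.+ s
  by-cases (yes in′) = trans (inside in′) (cong (ℚ._+ s) (sym (*-identityˡ (μ u x))))
  by-cases (no out)  = trans (outside out) (cong (ℚ._+ s) (sym (*-zeroˡ (μ u x))))

μ-diagonal : (u v : 𝔖 n) → u ≈ v → μ u v ≡ 1ℚ
μ-diagonal u v u≈v = go (<ʷ-wellFounded v)
  where
  -- `μ-acc` unfolds only on `acc`, so the accessibility proof is generalised first.
  go : (a : Acc _<ʷ_ v) → μ-acc u v a ≡ 1ℚ
  go (acc rs) = if-yes (u ≈? v) u≈v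

μ-recursion : (u v : 𝔖 n) → ¬ (u ≈ v) →
  μ u v ≡ - sumℚ (allPerms n) (λ x → ⟦ x <ʷ? v ⟧ * (⟦ u ≤ʷ? x ⟧ * μ u x))
μ-recursion {n} u v u≉v = trans (go (<ʷ-wellFounded v)) (cong -_ (sum-cong (allPerms n) λ x →
  trans (cong (_* μ u x) (⟦⟧-× (u ≤ʷ? x) (x <ʷ? v)))
    (trans (*-assoc ⟦ u ≤ʷ? x ⟧ ⟦ x <ʷ? v ⟧ (μ u x)) (*-swapˡ ⟦ u ≤ʷ? x ⟧ ⟦ x <ʷ? v ⟧ (μ u x)))))
  where
  go : (a : Acc _<ʷ_ v) → μ-acc u v a ≡ - sumℚ (allPerms n) (λ x → ⟦ u ≤ʷ? x ×-dec x <ʷ? v ⟧ * μ u x)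
  go (acc rs) = trans (if-no (u ≈? v) u≉v) (cong -_ (foldr-cong 0ℚ (μ-step≡ u v rs) (allPerms n)))

-- The pairing of 𝓜 u with a function on the 𝓕-basis.
möbius : 𝔖 n → (𝔖 n → ℚ) → ℚ
möbius {n} u g = sumℚ (filter (u ≤ʷ?_) (allPerms n)) (λ x → μ u x * g x)

möbius-cong : (u : 𝔖 n) {g h : 𝔖 n → ℚ} → (∀ x → g x ≡ h x) → möbius u g ≡ möbius u h
möbius-cong u eq = sum-cong (filter (u ≤ʷ?_) (allPerms _)) λ x → cong (μ u x *_) (eq x)

möbius-zero : (u : 𝔖 n) {g : 𝔖 n → ℚ} → (∀ x → g x ≡ 0ℚ) → möbius u g ≡ 0ℚ
möbius-zero u eq = sum-zero (filter (u ≤ʷ?_) (allPerms _)) λ x → trans (cong (μ u x *_) (eq x)) (*-zeroʳ (μ u x))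

möbius-*ˡ : (u : 𝔖 n) (c : ℚ) (g : 𝔖 n → ℚ) → möbius u (λ x → c * g x) ≡ c * möbius u g
möbius-*ˡ u c g = trans (sum-cong upper λ x → *-swapˡ (μ u x) c (g x)) (sum-*ˡ upper c λ x → μ u x * g x)
  where upper = filter (u ≤ʷ?_) (allPerms _)

möbius-sum : (u : 𝔖 n) (ys : List I) (g : 𝔖 n → I → ℚ) →
             möbius u (λ x → sumℚ ys (g x)) ≡ sumℚ ys (λ y → möbius u (λ x → g x y))
möbius-sum u ys g = trans (sum-cong upper λ x → sym (sum-*ˡ ys (μ u x) (g x))) (sum-swap upper ys λ x y → μ u x * g x y)
  where upper = filter (u ≤ʷ?_) (allPerms _)

-- The sum of μ(u,x) over the interval [u,y]. For u < y the recursion makes the top term the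
-- negative of the rest; the rest vanishes when `u ≈ y`, and every term does when u is not below y.
möbius-≤ʷ : (u y : 𝔖 n) → möbius u (λ x → ⟦ x ≤ʷ? y ⟧) ≡ ⟦ u ≈? y ⟧
möbius-≤ʷ {n} u y = begin
  möbius u (λ x → ⟦ x ≤ʷ? y ⟧)
    ≡⟨ sum-filter (u ≤ʷ?_) (allPerms n) (λ x → μ u x * ⟦ x ≤ʷ? y ⟧) ⟩
  sumℚ (allPerms n) (λ x → ⟦ u ≤ʷ? x ⟧ * (μ u x * ⟦ x ≤ʷ? y ⟧))
    ≡⟨ sum-cong (allPerms n) (λ x → trans (sym (*-assoc ⟦ u ≤ʷ? x ⟧ (μ u x) ⟦ x ≤ʷ? y ⟧)) (*-comm (f x) ⟦ x ≤ʷ? y ⟧)) ⟩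
  sumℚ (allPerms n) (λ x → ⟦ x ≤ʷ? y ⟧ * f x)
    ≡⟨ sum-≤ʷ y f f-resp ⟩
  below ℚ.+ f y
    ≡⟨ total (u ≈? y) (u ≤ʷ? y) ⟩
  ⟦ u ≈? y ⟧ ∎
  where
  f : 𝔖 n → ℚ
  f x = ⟦ u ≤ʷ? x ⟧ * μ u x

  f-resp : Respects≈ f
  f-resp x x′ x≈x′ = cong₂ _*_
    (⟦⟧-cong (u ≤ʷ? x) (u ≤ʷ? x′)
      (λ u≤x → ≤ʷ-trans {u = u} {x} {x′} u≤x (≤ʷ-reflexive {u = x} {x′} x≈x′))
      (λ u≤x′ → ≤ʷ-trans {u = u} {x′} {x} u≤x′ (≤ʷ-reflexive {u = x′} {x} (sym ∘ x≈x′))))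
    (μ-cong u x x′ x≈x′)

  below : ℚ
  below = sumℚ (allPerms n) (λ x → ⟦ x <ʷ? y ⟧ * f x)

  below≡0 : (∀ x → x <ʷ y → ¬ (u ≤ʷ x)) → below ≡ 0ℚ
  below≡0 empty = sum-zero (allPerms n) λ x →
    trans (⟦⟧-*-congʳ (x <ʷ? y) λ x<y → trans (cong (_* μ u x) (⟦⟧-no (u ≤ʷ? x) (empty x x<y))) (*-zeroˡ (μ u x)))
          (*-zeroʳ ⟦ x <ʷ? y ⟧)

  total : (d : Dec (u ≈ y)) (e : Dec (u ≤ʷ y)) → below ℚ.+ ⟦ e ⟧ * μ u y ≡ ⟦ d ⟧
  total (yes u≈y) e = cong₂ ℚ._+_
    (below≡0 λ x (x≤y , x≉y) u≤x → x≉y (≤ʷ-antisym {u = x} {y} x≤y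
      (≤ʷ-trans {u = y} {u} {x} (≤ʷ-reflexive {u = y} {u} (sym ∘ u≈y)) u≤x)))
    (cong₂ _*_ (⟦⟧-yes e (≤ʷ-reflexive {u = u} {y} u≈y)) (μ-diagonal u y u≈y))
  total (no u≉y) (yes _) = trans
    (cong (below ℚ.+_) (trans (*-identityˡ (μ u y)) (μ-recursion u y u≉y)))
    (+-inverseʳ below)
  total (no _) (no u≰y) = cong₂ ℚ._+_
    (below≡0 λ x (x≤y , _) u≤x → u≰y (≤ʷ-trans {u = u} {x} {y} u≤x x≤y))
    (*-zeroˡ (μ u y))

-- Linear functionals on 𝔖Sym

-- The linear functional with value `φ b` on the basis symbol `b`; coefficients and down-sums are
-- both of this form.
eval : 𝔖Sym → (Σ ℕ 𝔖 → ℚ) → ℚ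
eval X φ = sumℚ X λ t → proj₁ t * φ (proj₂ t)

coeff≡eval : ∀ X b → coeff X b ≡ eval X (λ b′ → ⟦ b′ ≈ᵇ? b ⟧)
coeff≡eval []            b = refl
coeff≡eval ((c , b′) ∷ X) b = cong₂ ℚ._+_ (select (b′ ≈ᵇ? b)) (coeff≡eval X b)
  where
  select : (d : Dec P) → (if does d then c else 0ℚ) ≡ c * ⟦ d ⟧
  select (yes _) = sym (*-identityʳ c)
  select (no _)  = sym (*-zeroʳ c)

eval-cong : ∀ X {φ ψ : Σ ℕ 𝔖 → ℚ} → (∀ b → φ b ≡ ψ b) → eval X φ ≡ eval X ψ
eval-cong X eq = sum-cong X λ t → cong (proj₁ t *_) (eq (proj₂ t))

eval-∑ : (xs : List I) (F : I → 𝔖Sym) (φ : Σ ℕ 𝔖 → ℚ) → eval (∑ xs F) φ ≡ sumℚ xs (λ x → eval (F x) φ)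
eval-∑ xs F φ = sum-concatMap xs F λ t → proj₁ t * φ (proj₂ t)

eval-• : ∀ c X φ → eval (c • X) φ ≡ c * eval X φ
eval-• c []            φ = sym (*-zeroʳ c)
eval-• c ((d , b) ∷ X) φ = trans (cong₂ ℚ._+_ (*-assoc c d (φ b)) (eval-• c X φ))
  (sym (*-distribˡ-+ c (d * φ b) (eval X φ)))

eval-𝓕 : (u : 𝔖 n) (φ : Σ ℕ 𝔖 → ℚ) → eval (𝓕 u) φ ≡ φ (n , u)
eval-𝓕 {n} u φ = trans (+-identityʳ (1ℚ * φ (n , u))) (*-identityˡ (φ (n , u)))

eval-· : ∀ X Y φ → eval (X · Y) φ ≡ eval X (λ a → eval Y (λ b → eval (𝓕-product (proj₂ a) (proj₂ b)) φ))
eval-· X Y φ = trans (eval-∑ X (λ s → ∑ Y λ t → (proj₁ s * proj₁ t) • prod s t) φ) (sum-cong X λ s → begin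
  eval (∑ Y λ t → (proj₁ s * proj₁ t) • prod s t) φ
    ≡⟨ eval-∑ Y (λ t → (proj₁ s * proj₁ t) • prod s t) φ ⟩
  sumℚ Y (λ t → eval ((proj₁ s * proj₁ t) • prod s t) φ)
    ≡⟨ sum-cong Y (λ t → trans (eval-• (proj₁ s * proj₁ t) (prod s t) φ) (*-assoc (proj₁ s) (proj₁ t) (eval (prod s t) φ))) ⟩
  sumℚ Y (λ t → proj₁ s * (proj₁ t * eval (prod s t) φ))
    ≡⟨ sum-*ˡ Y (proj₁ s) (λ t → proj₁ t * eval (prod s t) φ) ⟩
  proj₁ s * sumℚ Y (λ t → proj₁ t * eval (prod s t) φ) ∎)
  where
  prod : ℚ × Σ ℕ 𝔖 → ℚ × Σ ℕ 𝔖 → 𝔖Sym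
  prod s t = 𝓕-product (proj₂ (proj₂ s)) (proj₂ (proj₂ t))

eval-𝓜 : (u : 𝔖 n) (φ : Σ ℕ 𝔖 → ℚ) → eval (𝓜 u) φ ≡ möbius u (λ x → φ (n , x))
eval-𝓜 {n} u φ = trans (eval-∑ upper (λ x → μ u x • 𝓕 x) φ)
  (sum-cong upper λ x → trans (eval-• (μ u x) (𝓕 x) φ) (cong (μ u x *_) (eval-𝓕 x φ)))
  where upper = filter (u ≤ʷ?_) (allPerms n)

-- Since 𝓕_x is the sum of the 𝓜_y with y ≥ x, this functional reads off the coefficient of 𝓜_y.
-- Summing over `z` makes it defined on symbols of every degree.
down : 𝔖 n → Σ ℕ 𝔖 → ℚ
down {n} y b = sumℚ (allPerms n) λ z → ⟦ z ≤ʷ? y ⟧ * ⟦ b ≈ᵇ? (n , z) ⟧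

down-≤ʷ : (y x : 𝔖 n) → down y (n , x) ≡ ⟦ x ≤ʷ? y ⟧
down-≤ʷ {n} y x = trans
  (sum-cong (allPerms n) λ z → trans (*-comm ⟦ z ≤ʷ? y ⟧ _)
    (cong (_* ⟦ z ≤ʷ? y ⟧) (⟦⟧-cong ((n , x) ≈ᵇ? (n , z)) (z ≈? x) (λ { (sameDegree x≈z) → sym ∘ x≈z }) (λ z≈x → sameDegree (sym ∘ z≈x)))))
  (sum-δ x (λ z → ⟦ z ≤ʷ? y ⟧) λ z z′ z≈z′ → ⟦⟧-cong (z ≤ʷ? y) (z′ ≤ʷ? y)
    (≤ʷ-trans {u = z′} {z} {y} (≤ʷ-reflexive {u = z′} {z} (sym ∘ z≈z′)))
    (≤ʷ-trans {u = z} {z′} {y} (≤ʷ-reflexive {u = z} {z′} z≈z′)))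

down-degree : ∀ {m} (y : 𝔖 n) (x : 𝔖 m) → m ≢ n → down y (m , x) ≡ 0ℚ
down-degree {n} {m} y x m≢n = sum-zero (allPerms n) λ z →
  trans (cong (⟦ z ≤ʷ? y ⟧ *_) (⟦⟧-no ((m , x) ≈ᵇ? (n , z)) (λ { (sameDegree _) → m≢n refl }))) (*-zeroʳ ⟦ z ≤ʷ? y ⟧)

coeff-cong : ∀ X (u v : 𝔖 n) → u ≈ v → coeff X (n , u) ≡ coeff X (n , v)
coeff-cong {n} X u v u≈v = begin
  coeff X (n , u)                          ≡⟨ coeff≡eval X (n , u) ⟩
  eval X (λ b → ⟦ b ≈ᵇ? (n , u) ⟧)  ≡⟨ eval-cong X (λ b → ⟦⟧-cong (b ≈ᵇ? (n , u)) (b ≈ᵇ? (n , v))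
                                               (λ { (sameDegree e) → sameDegree (λ i → trans (e i) (u≈v i)) })
                                               (λ { (sameDegree e) → sameDegree (λ i → trans (e i) (sym (u≈v i))) })) ⟩
  eval X (λ b → ⟦ b ≈ᵇ? (n , v) ⟧)  ≡⟨ coeff≡eval X (n , v) ⟨
  coeff X (n , v)                          ∎

eval-down : ∀ X (y : 𝔖 n) → eval X (down y) ≡ sumℚ (allPerms n) (λ z → ⟦ z <ʷ? y ⟧ * coeff X (n , z)) ℚ.+ coeff X (n , y)
eval-down {n} X y = begin
  eval X (down y)
    ≡⟨ sum-cong X (λ t → sym (sum-*ˡ (allPerms n) (proj₁ t) λ z → ⟦ z ≤ʷ? y ⟧ * ⟦ proj₂ t ≈ᵇ? (n , z) ⟧)) ⟩
  sumℚ X (λ t → sumℚ (allPerms n) (λ z → proj₁ t * (⟦ z ≤ʷ? y ⟧ * ⟦ proj₂ t ≈ᵇ? (n , z) ⟧)))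
    ≡⟨ sum-swap X (allPerms n) (λ t z → proj₁ t * (⟦ z ≤ʷ? y ⟧ * ⟦ proj₂ t ≈ᵇ? (n , z) ⟧)) ⟩
  sumℚ (allPerms n) (λ z → sumℚ X (λ t → proj₁ t * (⟦ z ≤ʷ? y ⟧ * ⟦ proj₂ t ≈ᵇ? (n , z) ⟧)))
    ≡⟨ sum-cong (allPerms n) (λ z → trans
         (sum-cong X λ t → *-swapˡ (proj₁ t) ⟦ z ≤ʷ? y ⟧ ⟦ proj₂ t ≈ᵇ? (n , z) ⟧)
         (sum-*ˡ X ⟦ z ≤ʷ? y ⟧ λ t → proj₁ t * ⟦ proj₂ t ≈ᵇ? (n , z) ⟧)) ⟩
  sumℚ (allPerms n) (λ z → ⟦ z ≤ʷ? y ⟧ * eval X (λ b → ⟦ b ≈ᵇ? (n , z) ⟧))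
    ≡⟨ sum-cong (allPerms n) (λ z → cong (⟦ z ≤ʷ? y ⟧ *_) (sym (coeff≡eval X (n , z)))) ⟩
  sumℚ (allPerms n) (λ z → ⟦ z ≤ʷ? y ⟧ * coeff X (n , z))
    ≡⟨ sum-≤ʷ y (λ z → coeff X (n , z)) (coeff-cong X) ⟩
  sumℚ (allPerms n) (λ z → ⟦ z <ʷ? y ⟧ * coeff X (n , z)) ℚ.+ coeff X (n , y) ∎

-- Passing from coefficients to down-sums is unitriangular for the weak order: once the coefficients
-- strictly below `y` agree, they cancel from the two down-sums at `y` and leave the coefficients at
-- `y`.
down-separates : ∀ X Y → (∀ n (y : 𝔖 n) → eval X (down y) ≡ eval Y (down y)) → X ≋ Y
down-separates X Y same (n , y) = go y (<ʷ-wellFounded y)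
  where
  go : (y : 𝔖 n) → Acc _<ʷ_ y → coeff X (n , y) ≡ coeff Y (n , y)
  go y (acc rs) = ∙-cancelˡ (below Y) _ _ (begin
    below Y ℚ.+ coeff X (n , y)  ≡⟨ cong (ℚ._+ coeff X (n , y)) below-same ⟨
    below X ℚ.+ coeff X (n , y)  ≡⟨ eval-down X y ⟨
    eval X (down y)              ≡⟨ same n y ⟩
    eval Y (down y)              ≡⟨ eval-down Y y ⟩
    below Y ℚ.+ coeff Y (n , y)  ∎)
    where
    below : 𝔖Sym → ℚ
    below Z = sumℚ (allPerms n) (λ z → ⟦ z <ʷ? y ⟧ * coeff Z (n , z))

    below-same : below X ≡ below Y
    below-same = sum-cong (allPerms n) λ z → ⟦⟧-*-congʳ (z <ʷ? y) λ z<y → go z (rs z<y)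

-- Standardisation

injective⇒permutation : (f : Fin n → Fin n) → Injective _≡_ _≡_ f → 𝔖 n
injective⇒permutation f f-inj = permutation f
  (λ k → proj₁ (preimage f f-inj k))
  (λ k → proj₂ (preimage f f-inj k))
  (λ i → f-inj (proj₂ (preimage f f-inj (f i))))
  where
  preimage : ∀ {n} (f : Fin n → Fin n) → Injective _≡_ _≡_ f → ∀ k → ∃ λ i → f i ≡ k
  preimage {ℕ.suc m} f f-inj k with any? (λ i → f i Finₚ.≟ k)
  ... | yes found = found
  -- Punching out a missed value `k` would inject `ℕ.suc m` points into `m` points.
  ... | no missed = contradiction
    (Finₚ.injective⇒≤ {f = λ i → punchOut {i = k} {f i} (λ k≡fi → missed (i , sym k≡fi))}
      (λ {i} {j} eq → f-inj (Finₚ.punchOut-injective (λ k≡fi → missed (i , sym k≡fi)) (λ k≡fj → missed (j , sym k≡fj)) eq)))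
    ℕₚ.1+n≰n

module Standardisation {m n} (f : Fin m → Fin n) (f-inj : Injective _≡_ _≡_ f) where

  private
    smaller? : ∀ i → Decidable (λ j → f j Fin.< f i)
    smaller? i j = f j Finₚ.<? f i

    -- The point `i` itself is never counted, so the number of smaller values is below `m` and can
    -- serve as an entry numbered from 0.
    rank< : ∀ i → length (filter (smaller? i) (allFin m)) ℕ.< m
    rank< i = subst (length (filter (smaller? i) (allFin m)) ℕ.<_) (length-tabulate (λ j → j))
      (filter-notAll (smaller? i) (allFin m) (lose (∈-allFin i) (ℕₚ.<-irrefl refl)))

    rank : Fin m → Fin m
    rank i = fromℕ< (rank< i)

    -- The points with value below `f i` all have value below `f j`, and `i` is a further one of the
    -- latter.
    rank-mono : ∀ i j → f i Fin.< f j → rank i Fin.< rank j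
    rank-mono i j fi<fj = subst₂ ℕ._<_ (sym (toℕ-fromℕ< (rank< i))) (sym (toℕ-fromℕ< (rank< j)))
      (length-filter-< (smaller? i) (smaller? j) (λ k fk<fi → ℕₚ.<-trans fk<fi fi<fj)
        fi<fj (ℕₚ.<-irrefl refl) (∈-allFin i))

    rank-injective : Injective _≡_ _≡_ rank
    rank-injective {i} {j} eq with Finₚ.<-cmp (f i) (f j)
    ... | tri< lt _ _ = contradiction (rank-mono i j lt) (ℕₚ.<-irrefl (cong toℕ eq))
    ... | tri≈ _ e _  = f-inj e
    ... | tri> _ _ gt = contradiction (rank-mono j i gt) (ℕₚ.<-irrefl (cong toℕ (sym eq)))

  st : 𝔖 m
  st = injective⇒permutation rank rank-injective

  st-mono : ∀ i j → f i Fin.< f j → st ⟨$⟩ʳ i Fin.< st ⟨$⟩ʳ j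
  st-mono = rank-mono

  st-reflect : ∀ i j → st ⟨$⟩ʳ i Fin.< st ⟨$⟩ʳ j → f i Fin.< f j
  st-reflect i j lt with Finₚ.<-cmp (f i) (f j)
  ... | tri< fi<fj _ _ = fi<fj
  ... | tri≈ _ e _     = contradiction lt (ℕₚ.<-irrefl (cong (toℕ ∘ rank) (f-inj e)))
  ... | tri> _ _ fj<fi = contradiction lt (ℕₚ.<-asym (rank-mono j i fj<fi))

-- The fibres of (u , v) ↦ (u ×ₚ v) ·ₚ flip ζ below y

⟨$⟩ʳ-injective : (π : 𝔖 n) → Injective _≡_ _≡_ (π ⟨$⟩ʳ_)
⟨$⟩ʳ-injective π {i} {j} eq = trans (sym (inverseˡ π)) (trans (cong (π ⟨$⟩ˡ_) eq) (inverseˡ π))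

module Restriction {p q} (ζ y : 𝔖 (p + q)) where

  private
    module L = Standardisation (λ i → y ⟨$⟩ʳ (ζ ⟨$⟩ʳ (i ↑ˡ q)))
      (λ eq → ↑ˡ-injective q _ _ (⟨$⟩ʳ-injective ζ (⟨$⟩ʳ-injective y eq)))
    module R = Standardisation (λ j → y ⟨$⟩ʳ (ζ ⟨$⟩ʳ (p ↑ʳ j)))
      (λ eq → ↑ʳ-injective p _ _ (⟨$⟩ʳ-injective ζ (⟨$⟩ʳ-injective y eq)))

  left : 𝔖 p
  left = L.st

  right : 𝔖 q
  right = R.st

  -- In `(u ×ₚ v) ·ₚ flip ζ` all values on the left block are smaller than those on the right block.
  -- So its inversions between the blocks are the same for all `u` and `v`: the pairs in which the
  -- right block's position comes first.
  Cross : Set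
  Cross = ∀ (i : Fin p) (j : Fin q) → (ζ ⟨$⟩ʳ (p ↑ʳ j)) Fin.< (ζ ⟨$⟩ʳ (i ↑ˡ q)) →
          (y ⟨$⟩ʳ (ζ ⟨$⟩ʳ (i ↑ˡ q))) Fin.< (y ⟨$⟩ʳ (ζ ⟨$⟩ʳ (p ↑ʳ j)))

  cross? : Dec Cross
  cross? = all? λ i → all? λ j → (ζ ⟨$⟩ʳ (p ↑ʳ j)) Finₚ.<? (ζ ⟨$⟩ʳ (i ↑ˡ q)) →-dec
    (y ⟨$⟩ʳ (ζ ⟨$⟩ʳ (i ↑ˡ q))) Finₚ.<? (y ⟨$⟩ʳ (ζ ⟨$⟩ʳ (p ↑ʳ j)))

  Fibre : 𝔖 p → 𝔖 q → Set
  Fibre u v = Cross × u ≤ʷ left × v ≤ʷ right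

  private
    ↑ˡ<↑ʳ : (i : Fin p) (j : Fin q) → i ↑ˡ q Fin.< p ↑ʳ j
    ↑ˡ<↑ʳ i j = subst₂ ℕ._<_ (sym (toℕ-↑ˡ i q)) (sym (toℕ-↑ʳ p j)) (ℕₚ.<-≤-trans (toℕ<n i) (ℕₚ.m≤m+n p (toℕ j)))

    ↑ˡ-mono : ∀ {i j : Fin p} → i Fin.< j → i ↑ˡ q Fin.< j ↑ˡ q
    ↑ˡ-mono {i} {j} = subst₂ ℕ._<_ (sym (toℕ-↑ˡ i q)) (sym (toℕ-↑ˡ j q))

    ↑ˡ-reflect : ∀ {i j : Fin p} → i ↑ˡ q Fin.< j ↑ˡ q → i Fin.< j
    ↑ˡ-reflect {i} {j} = subst₂ ℕ._<_ (toℕ-↑ˡ i q) (toℕ-↑ˡ j q)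

    ↑ʳ-mono : ∀ {i j : Fin q} → i Fin.< j → p ↑ʳ i Fin.< p ↑ʳ j
    ↑ʳ-mono {i} {j} i<j = subst₂ ℕ._<_ (sym (toℕ-↑ʳ p i)) (sym (toℕ-↑ʳ p j)) (ℕₚ.+-monoʳ-< p i<j)

    ↑ʳ-reflect : ∀ {i j : Fin q} → p ↑ʳ i Fin.< p ↑ʳ j → i Fin.< j
    ↑ʳ-reflect {i} {j} lt = ℕₚ.+-cancelˡ-< p _ _ (subst₂ ℕ._<_ (toℕ-↑ʳ p i) (toℕ-↑ʳ p j) lt)

    reflects : ∀ {m k} {g : Fin m → Fin k} → (∀ i j → i Fin.< j → g i Fin.< g j) → ∀ i j → g i Fin.< g j → i Fin.< j
    reflects {g = g} mono i j gi<gj with Finₚ.<-cmp i j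
    ... | tri< i<j _ _  = i<j
    ... | tri≈ _ refl _ = contradiction gi<gj (ℕₚ.<-irrefl refl)
    ... | tri> _ _ j<i  = contradiction gi<gj (ℕₚ.<-asym (mono j i j<i))

    -- Matching on a `Block` turns a position into the form `ζ` of a left or right index, where
    -- `ρ-left` and `ρ-right` give the value of `ρ`.
    data Block : Fin (p + q) → Set where
      inLeft  : ∀ i → Block (ζ ⟨$⟩ʳ (i ↑ˡ q))
      inRight : ∀ j → Block (ζ ⟨$⟩ʳ (p ↑ʳ j))

    block : ∀ k → Block k
    block k = subst Block (inverseʳ ζ)
      (subst (λ l → Block (ζ ⟨$⟩ʳ l)) (join-splitAt p q (ζ ⟨$⟩ˡ k)) (fromSum (splitAt p (ζ ⟨$⟩ˡ k))))
      where
      fromSum : (s : Fin p ⊎ Fin q) → Block (ζ ⟨$⟩ʳ join p q s)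
      fromSum (inj₁ i) = inLeft i
      fromSum (inj₂ j) = inRight j

  module _ (u : 𝔖 p) (v : 𝔖 q) where

    private
      ρ : 𝔖 (p + q)
      ρ = (u ×ₚ v) ·ₚ flip ζ

      ρ-left : ∀ i → ρ ⟨$⟩ʳ (ζ ⟨$⟩ʳ (i ↑ˡ q)) ≡ (u ⟨$⟩ʳ i) ↑ˡ q
      ρ-left i = trans (cong ((u ×ₚ v) ⟨$⟩ʳ_) (inverseˡ ζ)) (×ₚ-left u v i)

      ρ-right : ∀ j → ρ ⟨$⟩ʳ (ζ ⟨$⟩ʳ (p ↑ʳ j)) ≡ p ↑ʳ (v ⟨$⟩ʳ j)
      ρ-right j = trans (cong ((u ×ₚ v) ⟨$⟩ʳ_) (inverseˡ ζ)) (×ₚ-right u v j)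

    -- As `ζ` increases on each block, inversions of `u` and `v` become inversions of `ρ`, hence of
    -- `y`, and standardisation preserves the order of the values of `y`.
    below⇒fibre : IsShuffle p q ζ → ρ ≤ʷ y → Fibre u v
    below⇒fibre (monoL , monoR) ρ≤y =
      (λ i j lt → proj₂ (ρ≤y _ (lt , subst₂ Fin._<_ (sym (ρ-left i)) (sym (ρ-right j)) (↑ˡ<↑ʳ _ _)))) ,
      (λ (i , j) (i<j , uj<ui) → i<j , L.st-mono j i
        (proj₂ (ρ≤y _ (monoL i j i<j , subst₂ Fin._<_ (sym (ρ-left j)) (sym (ρ-left i)) (↑ˡ-mono uj<ui))))) ,
      (λ (i , j) (i<j , vj<vi) → i<j , R.st-mono j i
        (proj₂ (ρ≤y _ (monoR i j i<j , subst₂ Fin._<_ (sym (ρ-right j)) (sym (ρ-right i)) (↑ʳ-mono vj<vi)))))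

    -- An inversion of `ρ` is sorted by the blocks of its two positions: inside a block it comes
    -- from `u` or `v`, and between blocks `Cross` handles it.
    fibre⇒below : IsShuffle p q ζ → Fibre u v → ρ ≤ʷ y
    fibre⇒below (monoL , monoR) (cross , u≤ , v≤) (k , l) (k<l , ρl<ρk) = k<l , go (block k) (block l) k<l ρl<ρk
      where
      go : ∀ {k l} → Block k → Block l → k Fin.< l → ρ ⟨$⟩ʳ l Fin.< ρ ⟨$⟩ʳ k → y ⟨$⟩ʳ l Fin.< y ⟨$⟩ʳ k
      go (inLeft i) (inLeft j) k<l lt = L.st-reflect j i (proj₂ (u≤ (i , j)
        (reflects monoL i j k<l , ↑ˡ-reflect (subst₂ Fin._<_ (ρ-left j) (ρ-left i) lt))))
      go (inRight i) (inRight j) k<l lt = R.st-reflect j i (proj₂ (v≤ (i , j)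
        (reflects monoR i j k<l , ↑ʳ-reflect (subst₂ Fin._<_ (ρ-right j) (ρ-right i) lt))))
      go (inRight j) (inLeft i) k<l _ = cross i j k<l
      -- With the left position first there is no inversion, since `ρ` is smaller on the left block.
      go (inLeft i) (inRight j) _ lt = contradiction (↑ˡ<↑ʳ _ _)
        (ℕₚ.<-asym (subst₂ Fin._<_ (ρ-right j) (ρ-left i) lt))

    -- The dependence on `u` and on `v` sits in separate factors, so a double Möbius sum over them
    -- splits.
    ⟦below⟧ : IsShuffle p q ζ → ⟦ ρ ≤ʷ? y ⟧ ≡ ⟦ cross? ⟧ * (⟦ u ≤ʷ? left ⟧ * ⟦ v ≤ʷ? right ⟧)
    ⟦below⟧ sh = begin
      ⟦ ρ ≤ʷ? y ⟧
        ≡⟨ ⟦⟧-cong (ρ ≤ʷ? y) (cross? ×-dec u ≤ʷ? left ×-dec v ≤ʷ? right) (below⇒fibre sh) (fibre⇒below sh) ⟩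
      ⟦ cross? ×-dec u ≤ʷ? left ×-dec v ≤ʷ? right ⟧
        ≡⟨ ⟦⟧-× cross? (u ≤ʷ? left ×-dec v ≤ʷ? right) ⟩
      ⟦ cross? ⟧ * ⟦ u ≤ʷ? left ×-dec v ≤ʷ? right ⟧
        ≡⟨ cong (⟦ cross? ⟧ *_) (⟦⟧-× (u ≤ʷ? left) (v ≤ʷ? right)) ⟩
      ⟦ cross? ⟧ * (⟦ u ≤ʷ? left ⟧ * ⟦ v ≤ʷ? right ⟧) ∎

  module _ (u : 𝔖 p) (v : 𝔖 q) where

    A⇒top : A u v y ζ → IsShuffle p q ζ × Cross × u ≈ left × v ≈ right
    A⇒top (sh , ρ≤y , maximal) =
      let cross , u≤ , v≤ = below⇒fibre u v sh ρ≤y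
          -- `left` and `right` themselves form a pair in the fibre above `u` and `v`, so maximality
          -- forces equality with it.
          left≈u , right≈v = maximal left right u≤ v≤ (fibre⇒below left right sh
            (cross , ≤ʷ-reflexive {u = left} {left} (λ _ → refl) , ≤ʷ-reflexive {u = right} {right} (λ _ → refl)))
      in sh , cross , (sym ∘ left≈u) , (sym ∘ right≈v)

    top⇒A : IsShuffle p q ζ × Cross × u ≈ left × v ≈ right → A u v y ζ
    top⇒A (sh , cross , u≈ , v≈) =
      sh ,
      fibre⇒below u v sh (cross , ≤ʷ-reflexive {u = u} {left} u≈ , ≤ʷ-reflexive {u = v} {right} v≈) ,
      -- Any competitor lies in the fibre, hence below `left` and `right`, which are `u` and `v` up
      -- to `≈`.
      λ u′ v′ u≤u′ v≤v′ ρ′≤y → let _ , u′≤ , v′≤ = below⇒fibre u′ v′ sh ρ′≤y in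
        ≤ʷ-antisym {u = u′} {u} (≤ʷ-trans {u = u′} {left} {u} u′≤ (≤ʷ-reflexive {u = left} {u} (sym ∘ u≈))) u≤u′ ,
        ≤ʷ-antisym {u = v′} {v} (≤ʷ-trans {u = v′} {right} {v} v′≤ (≤ʷ-reflexive {u = right} {v} (sym ∘ v≈))) v≤v′

    ⟦A⟧ : ⟦ A? u v y ζ ⟧ ≡ ⟦ isShuffle? p q ζ ⟧ * (⟦ cross? ⟧ * (⟦ u ≈? left ⟧ * ⟦ v ≈? right ⟧))
    ⟦A⟧ = begin
      ⟦ A? u v y ζ ⟧
        ≡⟨ ⟦⟧-cong (A? u v y ζ) (isShuffle? p q ζ ×-dec cross? ×-dec u ≈? left ×-dec v ≈? right) A⇒top top⇒A ⟩
      ⟦ isShuffle? p q ζ ×-dec cross? ×-dec u ≈? left ×-dec v ≈? right ⟧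
        ≡⟨ ⟦⟧-× (isShuffle? p q ζ) (cross? ×-dec u ≈? left ×-dec v ≈? right) ⟩
      ⟦ isShuffle? p q ζ ⟧ * ⟦ cross? ×-dec u ≈? left ×-dec v ≈? right ⟧
        ≡⟨ cong (⟦ isShuffle? p q ζ ⟧ *_) (trans (⟦⟧-× cross? (u ≈? left ×-dec v ≈? right))
             (cong (⟦ cross? ⟧ *_) (⟦⟧-× (u ≈? left) (v ≈? right)))) ⟩
      ⟦ isShuffle? p q ζ ⟧ * (⟦ cross? ⟧ * (⟦ u ≈? left ⟧ * ⟦ v ≈? right ⟧)) ∎

    -- Neither `right` nor `cross?` depends on `u′`, so the inner sum collapses to a factor that
    -- leaves the outer sum, and then the outer sum collapses in the same way.
    möbius-fibre : IsShuffle p q ζ →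
      möbius u (λ u′ → möbius v (λ v′ → ⟦ (u′ ×ₚ v′) ·ₚ flip ζ ≤ʷ? y ⟧)) ≡ ⟦ cross? ⟧ * (⟦ u ≈? left ⟧ * ⟦ v ≈? right ⟧)
    möbius-fibre sh = begin
      möbius u (λ u′ → möbius v (λ v′ → ⟦ (u′ ×ₚ v′) ·ₚ flip ζ ≤ʷ? y ⟧))
        ≡⟨ möbius-cong u (λ u′ → begin
             möbius v (λ v′ → ⟦ (u′ ×ₚ v′) ·ₚ flip ζ ≤ʷ? y ⟧)
               ≡⟨ möbius-cong v (λ v′ → trans (⟦below⟧ u′ v′ sh) (sym (*-assoc ⟦ cross? ⟧ ⟦ u′ ≤ʷ? left ⟧ ⟦ v′ ≤ʷ? right ⟧))) ⟩
             möbius v (λ v′ → ⟦ cross? ⟧ * ⟦ u′ ≤ʷ? left ⟧ * ⟦ v′ ≤ʷ? right ⟧)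
               ≡⟨ möbius-*ˡ v (⟦ cross? ⟧ * ⟦ u′ ≤ʷ? left ⟧) (λ v′ → ⟦ v′ ≤ʷ? right ⟧) ⟩
             ⟦ cross? ⟧ * ⟦ u′ ≤ʷ? left ⟧ * möbius v (λ v′ → ⟦ v′ ≤ʷ? right ⟧)
               ≡⟨ cong (⟦ cross? ⟧ * ⟦ u′ ≤ʷ? left ⟧ *_) (möbius-≤ʷ v right) ⟩
             ⟦ cross? ⟧ * ⟦ u′ ≤ʷ? left ⟧ * ⟦ v ≈? right ⟧
               ≡⟨ rotate ⟦ cross? ⟧ ⟦ u′ ≤ʷ? left ⟧ ⟦ v ≈? right ⟧ ⟩
             ⟦ cross? ⟧ * ⟦ v ≈? right ⟧ * ⟦ u′ ≤ʷ? left ⟧ ∎) ⟩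
      möbius u (λ u′ → ⟦ cross? ⟧ * ⟦ v ≈? right ⟧ * ⟦ u′ ≤ʷ? left ⟧)
        ≡⟨ möbius-*ˡ u (⟦ cross? ⟧ * ⟦ v ≈? right ⟧) (λ u′ → ⟦ u′ ≤ʷ? left ⟧) ⟩
      ⟦ cross? ⟧ * ⟦ v ≈? right ⟧ * möbius u (λ u′ → ⟦ u′ ≤ʷ? left ⟧)
        ≡⟨ cong (⟦ cross? ⟧ * ⟦ v ≈? right ⟧ *_) (möbius-≤ʷ u left) ⟩
      ⟦ cross? ⟧ * ⟦ v ≈? right ⟧ * ⟦ u ≈? left ⟧
        ≡⟨ trans (rotate ⟦ cross? ⟧ ⟦ v ≈? right ⟧ ⟦ u ≈? left ⟧) (*-assoc ⟦ cross? ⟧ ⟦ u ≈? left ⟧ ⟦ v ≈? right ⟧) ⟩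
      ⟦ cross? ⟧ * (⟦ u ≈? left ⟧ * ⟦ v ≈? right ⟧) ∎
      where
      rotate : ∀ a b c → a * b * c ≡ a * c * b
      rotate a b c = trans (*-assoc a b c) (trans (cong (a *_) (*-comm b c)) (sym (*-assoc a c b)))

-- Down-sums of the two sides of the product formula

α-cong : (u : 𝔖 p) (v : 𝔖 q) (w w′ : 𝔖 (p + q)) → w ≈ w′ → fromℕ (α u v w) ≡ fromℕ (α u v w′)
α-cong {p} {q} u v w w′ w≈w′ = trans (fromℕ-length-filter (A? u v w) (allPerms (p + q)))
  (trans (sum-cong (allPerms (p + q)) λ ζ → ⟦⟧-cong (A? u v w ζ) (A? u v w′ ζ)
      (transport ζ w w′ w≈w′) (transport ζ w′ w (sym ∘ w≈w′)))
    (sym (fromℕ-length-filter (A? u v w′) (allPerms (p + q)))))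
  where
  transport : ∀ ζ (w w′ : 𝔖 (p + q)) → w ≈ w′ → A u v w ζ → A u v w′ ζ
  transport ζ w w′ w≈w′ (sh , ρ≤w , maximal) =
    sh ,
    ≤ʷ-trans {u = (u ×ₚ v) ·ₚ flip ζ} {w} {w′} ρ≤w (≤ʷ-reflexive {u = w} {w′} w≈w′) ,
    λ u′ v′ u≤u′ v≤v′ ρ′≤w′ → maximal u′ v′ u≤u′ v≤v′
      (≤ʷ-trans {u = (u′ ×ₚ v′) ·ₚ flip ζ} {w′} {w} ρ′≤w′ (≤ʷ-reflexive {u = w′} {w} (sym ∘ w≈w′)))

eval-𝓕-product : (u : 𝔖 p) (v : 𝔖 q) (φ : Σ ℕ 𝔖 → ℚ) →
  eval (𝓕-product u v) φ ≡ sumℚ (shuffles p q) (λ ζ → φ (p + q , (u ×ₚ v) ·ₚ flip ζ))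
eval-𝓕-product {p} {q} u v φ = trans (eval-∑ (shuffles p q) (λ ζ → 𝓕 ((u ×ₚ v) ·ₚ flip ζ)) φ)
  (sum-cong (shuffles p q) λ ζ → eval-𝓕 ((u ×ₚ v) ·ₚ flip ζ) φ)

-- Holding for every `φ`, this serves for down-sums in degree `p + q` and in all other degrees.
eval-𝓜·𝓜 : (u : 𝔖 p) (v : 𝔖 q) (φ : Σ ℕ 𝔖 → ℚ) →
  eval (𝓜 u · 𝓜 v) φ ≡ möbius u (λ u′ → möbius v (λ v′ → sumℚ (shuffles p q) (λ ζ → φ (p + q , (u′ ×ₚ v′) ·ₚ flip ζ))))
eval-𝓜·𝓜 {p} {q} u v φ = begin
  eval (𝓜 u · 𝓜 v) φ
    ≡⟨ eval-· (𝓜 u) (𝓜 v) φ ⟩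
  eval (𝓜 u) (λ a → eval (𝓜 v) (λ b → eval (𝓕-product (proj₂ a) (proj₂ b)) φ))
    ≡⟨ eval-𝓜 u (λ a → eval (𝓜 v) (λ b → eval (𝓕-product (proj₂ a) (proj₂ b)) φ)) ⟩
  möbius u (λ u′ → eval (𝓜 v) (λ b → eval (𝓕-product u′ (proj₂ b)) φ))
    ≡⟨ möbius-cong u (λ u′ → trans (eval-𝓜 v (λ b → eval (𝓕-product u′ (proj₂ b)) φ))
         (möbius-cong v λ v′ → eval-𝓕-product u′ v′ φ)) ⟩
  möbius u (λ u′ → möbius v (λ v′ → sumℚ (shuffles p q) (λ ζ → φ (p + q , (u′ ×ₚ v′) ·ₚ flip ζ)))) ∎

down-𝓜·𝓜 : (u : 𝔖 p) (v : 𝔖 q) (y : 𝔖 (p + q)) → eval (𝓜 u · 𝓜 v) (down y) ≡ fromℕ (α u v y)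
down-𝓜·𝓜 {p} {q} u v y = begin
  eval (𝓜 u · 𝓜 v) (down y)
    ≡⟨ eval-𝓜·𝓜 u v (down y) ⟩
  möbius u (λ u′ → möbius v (λ v′ → sumℚ (shuffles p q) (λ ζ → down y (p + q , (u′ ×ₚ v′) ·ₚ flip ζ))))
    ≡⟨ möbius-cong u (λ u′ → möbius-cong v λ v′ → sum-cong (shuffles p q) λ ζ → down-≤ʷ y ((u′ ×ₚ v′) ·ₚ flip ζ)) ⟩
  möbius u (λ u′ → möbius v (λ v′ → sumℚ (shuffles p q) (λ ζ → ⟦ (u′ ×ₚ v′) ·ₚ flip ζ ≤ʷ? y ⟧)))
    -- The sum over shuffles is moved outermost, so that for each fixed `ζ` the Möbius sums yield
    -- the indicator of membership in `A`.
    ≡⟨ möbius-cong u (λ u′ → möbius-sum v (shuffles p q) λ v′ ζ → ⟦ (u′ ×ₚ v′) ·ₚ flip ζ ≤ʷ? y ⟧) ⟩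
  möbius u (λ u′ → sumℚ (shuffles p q) (λ ζ → möbius v (λ v′ → ⟦ (u′ ×ₚ v′) ·ₚ flip ζ ≤ʷ? y ⟧)))
    ≡⟨ möbius-sum u (shuffles p q) (λ u′ ζ → möbius v (λ v′ → ⟦ (u′ ×ₚ v′) ·ₚ flip ζ ≤ʷ? y ⟧)) ⟩
  sumℚ (shuffles p q) (λ ζ → möbius u (λ u′ → möbius v (λ v′ → ⟦ (u′ ×ₚ v′) ·ₚ flip ζ ≤ʷ? y ⟧)))
    ≡⟨ sum-filter (isShuffle? p q) (allPerms (p + q)) (λ ζ → möbius u (λ u′ → möbius v (λ v′ → ⟦ (u′ ×ₚ v′) ·ₚ flip ζ ≤ʷ? y ⟧))) ⟩
  sumℚ (allPerms (p + q)) (λ ζ → ⟦ isShuffle? p q ζ ⟧ * möbius u (λ u′ → möbius v (λ v′ → ⟦ (u′ ×ₚ v′) ·ₚ flip ζ ≤ʷ? y ⟧)))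
    ≡⟨ sum-cong (allPerms (p + q)) (λ ζ → trans
         (⟦⟧-*-congʳ (isShuffle? p q ζ) (Restriction.möbius-fibre ζ y u v))
         (sym (Restriction.⟦A⟧ ζ y u v))) ⟩
  sumℚ (allPerms (p + q)) (λ ζ → ⟦ A? u v y ζ ⟧)
    ≡⟨ fromℕ-length-filter (A? u v y) (allPerms (p + q)) ⟨
  fromℕ (α u v y) ∎

-- The functionals `down y` are dual to the elements `𝓜 w`, by `möbius-≤ʷ`.
down-∑𝓜 : (c : 𝔖 n → ℚ) → Respects≈ c → (y : 𝔖 n) → eval (∑[ w ∈ allPerms n ] (c w • 𝓜 w)) (down y) ≡ c y
down-∑𝓜 {n} c c-resp y = begin
  eval (∑[ w ∈ allPerms n ] (c w • 𝓜 w)) (down y)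
    ≡⟨ eval-∑ (allPerms n) (λ w → c w • 𝓜 w) (down y) ⟩
  sumℚ (allPerms n) (λ w → eval (c w • 𝓜 w) (down y))
    ≡⟨ sum-cong (allPerms n) (λ w → trans (eval-• (c w) (𝓜 w) (down y)) (trans
         (cong (c w *_) (trans (eval-𝓜 w (down y)) (trans (möbius-cong w (down-≤ʷ y)) (möbius-≤ʷ w y))))
         (*-comm (c w) ⟦ w ≈? y ⟧))) ⟩
  sumℚ (allPerms n) (λ w → ⟦ w ≈? y ⟧ * c w)
    ≡⟨ sum-δ y c c-resp ⟩
  c y ∎

mainTheorem7 : (p q : ℕ) → 1 ≤ p → 1 ≤ q → (u : 𝔖 p) (v : 𝔖 q) →
    𝓜 u · 𝓜 v ≋ ∑[ w ∈ allPerms (p + q) ] (fromℕ (α u v w) • 𝓜 w)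
mainTheorem7 p q _ _ u v = down-separates (𝓜 u · 𝓜 v) (∑[ w ∈ allPerms (p + q) ] (fromℕ (α u v w) • 𝓜 w))
  λ n y → by-degree n y (p + q ℕₚ.≟ n)
  where
  by-degree : ∀ n (y : 𝔖 n) → Dec (p + q ≡ n) → eval (𝓜 u · 𝓜 v) (down y) ≡ eval (∑[ w ∈ allPerms (p + q) ] (fromℕ (α u v w) • 𝓜 w)) (down y)
  by-degree n y (yes refl) = trans (down-𝓜·𝓜 u v y) (sym (down-∑𝓜 (λ w → fromℕ (α u v w)) (α-cong u v) y))
  -- Both sides are homogeneous of degree `p + q`, so every down-sum in another degree vanishes.
  by-degree n y (no p+q≢n) = trans
    (trans (eval-𝓜·𝓜 u v (down y)) (möbius-zero u λ u′ → möbius-zero v λ v′ → sum-zero (shuffles p q) λ ζ →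
      down-degree y ((u′ ×ₚ v′) ·ₚ flip ζ) p+q≢n))
    (sym (trans (eval-∑ (allPerms (p + q)) (λ w → fromℕ (α u v w) • 𝓜 w) (down y)) (sum-zero (allPerms (p + q)) λ w →
      trans (eval-• (fromℕ (α u v w)) (𝓜 w) (down y)) (trans
        (cong (fromℕ (α u v w) *_) (trans (eval-𝓜 w (down y)) (möbius-zero w λ x → down-degree y x p+q≢n)))
        (*-zeroʳ (fromℕ (α u v w)))))))
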